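{- For every $X\subseteq\{C,D,M\}$: every theorem of the axiomatic system $\mathbf{K}(X)$ is a valid $\mathcal{ELX}$-formula, and every theorem of the axiomatic system $\mathbf{KB}(X)$ is an s-valid $\mathcal{ELX}$-formula. (That is, each of the sixteen systems $\mathbf{K}(X)$, $\mathbf{KB}(X)$ is sound for its corresponding logic $\mathrm{ELX}$, $\mathrm{ELX}^s$.)
   Context: Languages. Fix a countably infinite set $\mathsf{Prop}$ and a finite nonempty set $\mathsf{Ag}$ of agents; groups are nonempty subsets of $\mathsf{Ag}$. $\mathcal{EL}$-formulas: $\varphi::=p\mid\neg\varphi\mid(\varphi\to\varphi)\mid K_a\varphi$ ($p\in\mathsf{Prop}$, $a\in\mathsf{Ag}$). For $X\subseteq\{C,D,M\}$, $\mathcal{ELX}$ adds $C_G\varphi$, $D_G\varphi$, $M_G\varphi$ ($G$ a group) for the respective letters in $X$. Other Boolean connectives are abbreviations; $E_G\varphi:=\bigwedge_{a\in G}K_a\varphi$, $E_G^1\varphi:=E_G\varphi$, $E_G^{n}\varphi:=E_GE_G^{n-1}\varphi$. Models. A model is $M=(W,A,E,C,\nu)$ with $W\neq\emptyset$, $A$ an arbitrary set, $E:W\times W\to\wp(A)$, $C:\mathsf{Ag}\to\wp(A)$, $\nu:W\to\wp(\mathsf{Prop})$. It is a similarity model if for all $s,t\in W$: $E(s,t)=A$ implies $s=t$, and $E(s,t)=E(t,s)$. Satisfaction: $M,s\models p$ iff $p\in\nu(s)$; Booleans as usual; $M,s\models K_a\psi$ iff $M,t\models\psi$ for all $t$ with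 $C(a)\subseteq E(s,t)$; $M,s\models C_G\psi$ iff $M,s\models E_G^n\psi$ for all $n\ge1$; $M,s\models D_G\psi$ iff $M,t\models\psi$ for all $t$ with $\bigcup_{a\in G}C(a)\subseteq E(s,t)$; $M,s\models M_G\psi$ iff $M,t\models\psi$ for all $t$ with $\bigcap_{a\in G}C(a)\subseteq E(s,t)$. A formula is valid (s-valid) if true at all states of all models (all similarity models). $\mathrm{ELX}$ ($\mathrm{ELX}^s$) is the set of valid (s-valid) $\mathcal{ELX}$-formulas. Axiomatic systems (schemes range over $\mathcal{ELX}$-formulas, agents $a$, groups $G,H$). Base $\mathbf K$: all instances of propositional tautologies; $K_a(\varphi\to\psi)\to(K_a\varphi\to K_a\psi)$; rules: from $\varphi$ and $\varphi\to\psi$ infer $\psi$; from $\varphi$ infer $K_a\varphi$. Base $\mathbf{KB}$: $\mathbf K$ plus $\varphi\to K_a\neg K_a\neg\varphi$. For $C$ (in both $\mathbf K(X)$ and $\mathbf{KB}(X)$): axiom $C_G\varphi\to\bigwedge_{a\in G}K_a(\varphi\wedge C_G\varphi)$; rule: from $\varphi\to\bigwedge_{a\in G}K_a(\varphi\wedge\psi)$ infer $\varphi\to C_G\psi$. For $D$: axioms $D_G(\varphi\to\psi)\to(D_G\varphi\to D_G\psi)$; $D_{\{a\}}\varphi\leftrightarrow K_a\varphi$; $D_G\varphi\to D_H\varphi$ for $G\subseteq H$; in $\mathbf{KB}(X)$ additionally $\varphi\to D_G\neg D_G\neg\varphi$. For $M$: axioms $M_G(\varphi\to\psi)\to(M_G\varphi\to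 M_G\psi)$; $M_{\{a\}}\varphi\leftrightarrow K_a\varphi$; $M_G\varphi\to M_H\varphi$ for $H\subseteq G$; in $\mathbf{KB}(X)$ additionally $\varphi\to M_G\neg M_G\neg\varphi$. $\mathbf K(X)$ (resp. $\mathbf{KB}(X)$) consists of the base system $\mathbf K$ (resp. $\mathbf{KB}$) together with the items listed for each letter in $X$; a theorem is a formula derivable from the axioms by the rules. -}

module Defs where

open import Axiom.ExcludedMiddle using (ExcludedMiddle)
open import Data.Bool using (Bool; true; not; _∨_; T)
open import Data.Empty using (⊥-elim)
open import Data.Fin using (Fin)
open import Data.Fin.Subset using (Subset; Nonempty; ⁅_⁆)
  renaming (_∈_ to _∈ₛ_; _⊆_ to _⊆ₛ_)
open import Data.Fin.Subset.Properties using (_∈?_; x∈⁅x⁆)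
open import Data.List using (List; []; _∷_; map; filter; allFin)
open import Data.List.Membership.Propositional using () renaming (_∈_ to _∈ₗ_)
open import Data.List.Membership.Propositional.Properties
  using (∈-allFin; ∈-filter⁺; ∈-filter⁻; ∈-map⁺; ∈-map⁻)
open import Data.List.Relation.Unary.Any using (here; there)
open import Data.Nat using (ℕ; zero; suc; _≤_)
open import Data.Product using (∃; _×_; _,_; proj₁; proj₂)
open import Function using (_⇔_; mk⇔; Equivalence)
open import Level using (Level) renaming (suc to lsuc)
open import Relation.Binary.PropositionalEquality using (_≡_; refl)
open import Relation.Nullary using (¬_; yes; no)
open import Relation.Unary using (Pred; _∈_; _⊆_; _≐_; Universal)

-- Prop is ℕ and Ag is Fin n; nonemptiness of Ag is a hypothesis on n.

record Group (n : ℕ) : Set where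
  constructor group
  field
    members   : Subset n
    -- irrelevant, so that groups with the same members are equal
    .nonempty : Nonempty members

open Group public using (members)

singleton : {n : ℕ} → Fin n → Group n
singleton a = group ⁅ a ⁆ (a , x∈⁅x⁆ a)

enumerate : {n : ℕ} → Group n → List (Fin n)
enumerate {n} G = filter (_∈? members G) (allFin n)

data Letter : Set where
  𝐂 𝐃 𝐌 : Letter

Letters : Set
Letters = Letter → Bool

infixr 6 _⇒_
infix  9 ~_

data Form (n : ℕ) (X : Letters) : Set where
  atom  : ℕ → Form n X
  ~_    : Form n X → Form n X
  _⇒_   : Form n X → Form n X → Form n X
  K     : Fin n → Form n X → Form n X
  C     : .{{_ : T (X 𝐂)}} → Group n → Form n X → Form n X
  D     : .{{_ : T (X 𝐃)}} → Group n → Form n X → Form n X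
  M     : .{{_ : T (X 𝐌)}} → Group n → Form n X → Form n X

module _ {n : ℕ} {X : Letters} where

  infixr 7 _⋏_
  infix  5 _⇔ᶠ_

  _⋏_ : Form n X → Form n X → Form n X
  φ ⋏ ψ = ~ (φ ⇒ ~ ψ)

  _⇔ᶠ_ : Form n X → Form n X → Form n X
  φ ⇔ᶠ ψ = (φ ⇒ ψ) ⋏ (ψ ⇒ φ)

  -- The empty case never arises for groups; its value is a tautology.
  ⋀ : List (Form n X) → Form n X
  ⋀ []           = atom 0 ⇒ atom 0
  ⋀ (φ ∷ [])     = φ
  ⋀ (φ ∷ ψ ∷ φs) = φ ⋏ ⋀ (ψ ∷ φs)

  Everyone : Group n → Form n X → Form n X
  Everyone G φ = ⋀ (map (λ a → K a φ) (enumerate G))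

  -- Everyone^ m is E_G^m for m ≥ 1.
  Everyone^ : ℕ → Group n → Form n X → Form n X
  Everyone^ zero    G φ = φ
  Everyone^ (suc m) G φ = Everyone G (Everyone^ m G φ)

record Model (n : ℕ) (ℓ : Level) : Set (lsuc ℓ) where
  field
    W         : Set ℓ
    inhabited : W
    A         : Set ℓ
    edge      : W → W → Pred A ℓ
    cap       : Fin n → Pred A ℓ
    ν         : W → Pred ℕ ℓ

  ⋃cap : Group n → Pred A ℓ
  ⋃cap G x = ∃ λ a → a ∈ₛ members G × x ∈ cap a

  ⋂cap : Group n → Pred A ℓ
  ⋂cap G x = ∀ a → a ∈ₛ members G → x ∈ cap a

  Box : Pred A ℓ → Pred W ℓ → Pred W ℓ
  Box S P s = ∀ t → S ⊆ edge s t → t ∈ P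

  EveryoneSem : Group n → Pred W ℓ → Pred W ℓ
  EveryoneSem G P s = ∀ a → a ∈ₛ members G → Box (cap a) P s

  EveryoneSem^ : ℕ → Group n → Pred W ℓ → Pred W ℓ
  EveryoneSem^ zero    G P = P
  EveryoneSem^ (suc m) G P = EveryoneSem G (EveryoneSem^ m G P)

open Model public using (W)

record IsSimilarity {n : ℕ} {ℓ : Level} (𝓜 : Model n ℓ) : Set ℓ where
  open Model 𝓜 using (edge)
  field
    full⇒≡ : ∀ s t → Universal (edge s t) → s ≡ t
    sym    : ∀ s t → edge s t ≐ edge t s

-- The clause for C asks for E_G^m ψ, m ≥ 1, which is not a subformula of
-- C_G ψ.  To keep the recursion structural the truth condition of E_G^m ψ is
-- written out semantically; ⊨C below recovers the clause in terms of formulas.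
infix 4 _,_⊨_

_,_⊨_ : {n : ℕ} {X : Letters} {ℓ : Level}
        (𝓜 : Model n ℓ) → W 𝓜 → Form n X → Set ℓ
𝓜 , s ⊨ atom p  = p ∈ Model.ν 𝓜 s
𝓜 , s ⊨ ~ φ     = ¬ (𝓜 , s ⊨ φ)
𝓜 , s ⊨ (φ ⇒ ψ) = 𝓜 , s ⊨ φ → 𝓜 , s ⊨ ψ
𝓜 , s ⊨ K a φ   = Model.Box 𝓜 (Model.cap 𝓜 a) (λ t → 𝓜 , t ⊨ φ) s
𝓜 , s ⊨ C G φ   = ∀ m → 1 ≤ m → Model.EveryoneSem^ 𝓜 m G (λ t → 𝓜 , t ⊨ φ) s
𝓜 , s ⊨ D G φ   = Model.Box 𝓜 (Model.⋃cap 𝓜 G) (λ t → 𝓜 , t ⊨ φ) s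
𝓜 , s ⊨ M G φ   = Model.Box 𝓜 (Model.⋂cap 𝓜 G) (λ t → 𝓜 , t ⊨ φ) s

Valid : {n : ℕ} {X : Letters} (ℓ : Level) → Form n X → Set (lsuc ℓ)
Valid {n} ℓ φ = (𝓜 : Model n ℓ) (s : W 𝓜) → 𝓜 , s ⊨ φ

SValid : {n : ℕ} {X : Letters} (ℓ : Level) → Form n X → Set (lsuc ℓ)
SValid {n} ℓ φ = (𝓜 : Model n ℓ) → IsSimilarity 𝓜 → (s : W 𝓜) → 𝓜 , s ⊨ φ

-- Excluded middle is needed because conjunction is an abbreviation.
module _ {n : ℕ} {X : Letters} {ℓ : Level} (em : ExcludedMiddle ℓ) (𝓜 : Model n ℓ) where
  open Model 𝓜 using (EveryoneSem^)
  open Equivalence using (to; from)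

  private
    stable : {P : Set ℓ} → ¬ ¬ P → P
    stable {P} ¬¬p with em {P}
    ... | yes p = p
    ... | no ¬p = ⊥-elim (¬¬p ¬p)

  ⊨⋏ : (φ ψ : Form n X) (s : W 𝓜) →
       (𝓜 , s ⊨ φ ⋏ ψ) ⇔ (𝓜 , s ⊨ φ × 𝓜 , s ⊨ ψ)
  ⊨⋏ φ ψ s = mk⇔ (λ h → stable (λ k → h (λ x y → k (x , y)))) (λ (x , y) h → h x y)

  ⊨⋀ : (φs : List (Form n X)) (s : W 𝓜) →
       (𝓜 , s ⊨ ⋀ φs) ⇔ (∀ {φ} → φ ∈ₗ φs → 𝓜 , s ⊨ φ)
  ⊨⋀ φs s = mk⇔ (fwd φs) (bwd φs)
    where
    fwd : ∀ φs → 𝓜 , s ⊨ ⋀ φs → ∀ {φ} → φ ∈ₗ φs → 𝓜 , s ⊨ φ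
    fwd (φ ∷ [])     h (here refl) = h
    fwd (φ ∷ ψ ∷ φs) h (here refl) = proj₁ (to (⊨⋏ φ (⋀ (ψ ∷ φs)) s) h)
    fwd (φ ∷ ψ ∷ φs) h (there i)   =
      fwd (ψ ∷ φs) (proj₂ (to (⊨⋏ φ (⋀ (ψ ∷ φs)) s) h)) i

    bwd : ∀ φs → (∀ {φ} → φ ∈ₗ φs → 𝓜 , s ⊨ φ) → 𝓜 , s ⊨ ⋀ φs
    bwd []           h = λ x → x
    bwd (φ ∷ [])     h = h (here refl)
    bwd (φ ∷ ψ ∷ φs) h = from (⊨⋏ φ (⋀ (ψ ∷ φs)) s)
      (h (here refl) , bwd (ψ ∷ φs) (λ i → h (there i)))

  ⊨Everyone : (G : Group n) (φ : Form n X) (s : W 𝓜) →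
              (𝓜 , s ⊨ Everyone G φ) ⇔
              (∀ a → a ∈ₛ members G → 𝓜 , s ⊨ K a φ)
  ⊨Everyone G φ s = mk⇔
    (λ h a a∈G → to (⊨⋀ boxes s) h
       (∈-map⁺ (λ b → K b φ) (∈-filter⁺ (_∈? members G) (∈-allFin a) a∈G)))
    (λ h → from (⊨⋀ boxes s) (λ i → box h (∈-map⁻ (λ b → K b φ) i)))
    where
    boxes : List (Form n X)
    boxes = map (λ a → K a φ) (enumerate G)

    box : ∀ {χ} → (∀ a → a ∈ₛ members G → 𝓜 , s ⊨ K a φ) →
          (∃ λ a → a ∈ₗ enumerate G × χ ≡ K a φ) → 𝓜 , s ⊨ χ
    box h (a , i , refl) =
      h a (proj₂ (∈-filter⁻ (_∈? members G) {xs = allFin n} i))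

  ⊨Everyone^ : (m : ℕ) (G : Group n) (φ : Form n X) (s : W 𝓜) →
               (𝓜 , s ⊨ Everyone^ m G φ) ⇔
               EveryoneSem^ m G (λ t → 𝓜 , t ⊨ φ) s
  ⊨Everyone^ zero    G φ s = mk⇔ (λ h → h) (λ h → h)
  ⊨Everyone^ (suc m) G φ s = mk⇔
    (λ h a a∈G t e → to (⊨Everyone^ m G φ t)
       (to (⊨Everyone G (Everyone^ m G φ) s) h a a∈G t (λ {x} → e {x})))
    (λ h → from (⊨Everyone G (Everyone^ m G φ) s)
       (λ a a∈G t e → from (⊨Everyone^ m G φ t) (h a a∈G t (λ {x} → e {x}))))

  ⊨C : .{{_ : T (X 𝐂)}} (G : Group n) (φ : Form n X) (s : W 𝓜) →
       (𝓜 , s ⊨ C G φ) ⇔ (∀ m → 1 ≤ m → 𝓜 , s ⊨ Everyone^ m G φ)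
  ⊨C G φ s = mk⇔
    (λ h m 1≤m → from (⊨Everyone^ m G φ s) (h m 1≤m))
    (λ h m 1≤m → to (⊨Everyone^ m G φ s) (h m 1≤m))

data PropForm : Set where
  var  : ℕ → PropForm
  neg  : PropForm → PropForm
  impl : PropForm → PropForm → PropForm

eval : (ℕ → Bool) → PropForm → Bool
eval v (var i)    = v i
eval v (neg α)    = not (eval v α)
eval v (impl α β) = not (eval v α) ∨ eval v β

Tautology : PropForm → Set
Tautology α = ∀ v → eval v α ≡ true

instantiate : {n : ℕ} {X : Letters} → (ℕ → Form n X) → PropForm → Form n X
instantiate σ (var i)    = σ i
instantiate σ (neg α)    = ~ instantiate σ α
instantiate σ (impl α β) = instantiate σ α ⇒ instantiate σ β

data Base : Set where
  𝐊 𝐊𝐁 : Base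

infix 4 _⟨_⟩⊢_

-- 𝐊 ⟨ X ⟩⊢ φ and 𝐊𝐁 ⟨ X ⟩⊢ φ are theoremhood in 𝐊(X) and in 𝐊𝐁(X).
data _⟨_⟩⊢_ {n : ℕ} : Base → (X : Letters) → Form n X → Set where
  taut : ∀ {b X} (α : PropForm) → Tautology α → (σ : ℕ → Form n X) →
         b ⟨ X ⟩⊢ instantiate σ α
  K-K  : ∀ {b X} (a : Fin n) (φ ψ : Form n X) →
         b ⟨ X ⟩⊢ K a (φ ⇒ ψ) ⇒ (K a φ ⇒ K a ψ)
  mp   : ∀ {b X} {φ ψ : Form n X} →
         b ⟨ X ⟩⊢ φ → b ⟨ X ⟩⊢ φ ⇒ ψ → b ⟨ X ⟩⊢ ψ
  nec  : ∀ {b X} (a : Fin n) {φ : Form n X} →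
         b ⟨ X ⟩⊢ φ → b ⟨ X ⟩⊢ K a φ
  K-B  : ∀ {X} (a : Fin n) (φ : Form n X) →
         𝐊𝐁 ⟨ X ⟩⊢ φ ⇒ K a (~ K a (~ φ))

  C-mix : ∀ {b X} .{{_ : T (X 𝐂)}} (G : Group n) (φ : Form n X) →
          b ⟨ X ⟩⊢ C G φ ⇒ Everyone G (φ ⋏ C G φ)
  C-ind : ∀ {b X} .{{_ : T (X 𝐂)}} (G : Group n) {φ ψ : Form n X} →
          b ⟨ X ⟩⊢ φ ⇒ Everyone G (φ ⋏ ψ) → b ⟨ X ⟩⊢ φ ⇒ C G ψ

  D-K   : ∀ {b X} .{{_ : T (X 𝐃)}} (G : Group n) (φ ψ : Form n X) →
          b ⟨ X ⟩⊢ D G (φ ⇒ ψ) ⇒ (D G φ ⇒ D G ψ)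
  D-one : ∀ {b X} .{{_ : T (X 𝐃)}} (a : Fin n) (φ : Form n X) →
          b ⟨ X ⟩⊢ D (singleton a) φ ⇔ᶠ K a φ
  D-sub : ∀ {b X} .{{_ : T (X 𝐃)}} (G H : Group n) (φ : Form n X) →
          members G ⊆ₛ members H → b ⟨ X ⟩⊢ D G φ ⇒ D H φ
  D-B   : ∀ {X} .{{_ : T (X 𝐃)}} (G : Group n) (φ : Form n X) →
          𝐊𝐁 ⟨ X ⟩⊢ φ ⇒ D G (~ D G (~ φ))

  M-K   : ∀ {b X} .{{_ : T (X 𝐌)}} (G : Group n) (φ ψ : Form n X) →
          b ⟨ X ⟩⊢ M G (φ ⇒ ψ) ⇒ (M G φ ⇒ M G ψ)
  M-one : ∀ {b X} .{{_ : T (X 𝐌)}} (a : Fin n) (φ : Form n X) →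
          b ⟨ X ⟩⊢ M (singleton a) φ ⇔ᶠ K a φ
  M-sub : ∀ {b X} .{{_ : T (X 𝐌)}} (G H : Group n) (φ : Form n X) →
          members H ⊆ₛ members G → b ⟨ X ⟩⊢ M G φ ⇒ M H φ
  M-B   : ∀ {X} .{{_ : T (X 𝐌)}} (G : Group n) (φ : Form n X) →
          𝐊𝐁 ⟨ X ⟩⊢ φ ⇒ M G (~ M G (~ φ))

{-# OPTIONS --safe #-}
module Submission where

-- K_a, D_G and M_G are all interpreted by Box S, for S = C(a), ⋃ C(a) and
-- ⋂ C(a), and Box S is antitone in the accessibility relation S ⊆ E(s,t), hence
-- monotone in S: this gives the axioms comparing modalities.  Of the similarity
-- conditions only symmetry of E matters, and only for the B axioms.

open import Axiom.ExcludedMiddle using (ExcludedMiddle)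
open import Data.Fin using (Fin)
open import Data.Fin.Subset using () renaming (_⊆_ to _⊆ₛ_)
open import Data.Fin.Subset.Properties using (x∈⁅x⁆; x∈⁅y⁆⇒x≡y)
open import Data.Nat using (ℕ; zero; suc; NonZero; s≤s; z≤n)
open import Data.Product using (_×_; _,_; proj₁; proj₂)
open import Function using (_⇔_; mk⇔; Equivalence)
open import Level using (Level)
open import Relation.Binary.PropositionalEquality using (_≡_; refl; sym; subst)
open import Relation.Nullary using (¬_; Reflects; does; proof)
open import Relation.Nullary.Reflects using (invert; ¬-reflects; _→-reflects_)
open import Relation.Unary using (Pred; _∈_; _⊆_) renaming (_⇒_ to _⇒ₚ_)
open import Defs

module _ {n : ℕ} {ℓ : Level} (𝓜 : Model n ℓ) where
  open Model 𝓜 hiding (W)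

  Box-K : (S : Pred A ℓ) {P Q : Pred (W 𝓜) ℓ} →
          Box S (P ⇒ₚ Q) ⊆ (Box S P ⇒ₚ Box S Q)
  Box-K S h k t S⊆e = h t S⊆e (k t S⊆e)

  Box-monoˡ : {S T : Pred A ℓ} (P : Pred (W 𝓜) ℓ) →
              S ⊆ T → Box S P ⊆ Box T P
  Box-monoˡ P S⊆T h t T⊆e = h t (λ x∈S → T⊆e (S⊆T x∈S))

  -- By symmetry, `S` also labels the edge from `t` back to `s`, so a box of `¬ P` at `t` would
  -- refute `P` at `s`.
  Box-B : IsSimilarity 𝓜 → (S : Pred A ℓ) (P : Pred (W 𝓜) ℓ) →
          P ⊆ Box S (λ t → ¬ Box S (λ u → ¬ P u) t)
  Box-B sim S P {s} p t S⊆e h =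
    h s (λ x∈S → proj₁ (IsSimilarity.sym sim s t) (S⊆e x∈S)) p

  ⋃cap-mono : (G H : Group n) → members G ⊆ₛ members H → ⋃cap G ⊆ ⋃cap H
  ⋃cap-mono G H G⊆H (a , a∈G , x∈a) = a , G⊆H a∈G , x∈a

  ⋂cap-anti : (G H : Group n) → members H ⊆ₛ members G → ⋂cap G ⊆ ⋂cap H
  ⋂cap-anti G H H⊆G x∈G a a∈H = x∈G a (H⊆G a∈H)

  cap⊆⋃cap : (a : Fin n) → cap a ⊆ ⋃cap (singleton a)
  cap⊆⋃cap a x∈a = a , x∈⁅x⁆ a , x∈a

  ⋃cap⊆cap : (a : Fin n) → ⋃cap (singleton a) ⊆ cap a
  ⋃cap⊆cap a {x} (b , b∈ , x∈b) = subst (λ c → x ∈ cap c) (x∈⁅y⁆⇒x≡y a b∈) x∈b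

  cap⊆⋂cap : (a : Fin n) → cap a ⊆ ⋂cap (singleton a)
  cap⊆⋂cap a {x} x∈a b b∈ = subst (λ c → x ∈ cap c) (sym (x∈⁅y⁆⇒x≡y a b∈)) x∈a

  ⋂cap⊆cap : (a : Fin n) → ⋂cap (singleton a) ⊆ cap a
  ⋂cap⊆cap a x∈ = x∈ a (x∈⁅x⁆ a)

  -- Induction on `m`: each step along an edge for an agent of `G` yields `P` again, and the last
  -- step yields `Q`. The offset `suc` matches the indices from 1 upwards in the clause for `C`.
  EveryoneSem^-coind : (G : Group n) {P Q : Pred (W 𝓜) ℓ} →
                       P ⊆ EveryoneSem G (λ t → P t × Q t) →
                       ∀ m → P ⊆ EveryoneSem^ (suc m) G Q
  EveryoneSem^-coind G step zero p a a∈G t e = proj₂ (step p a a∈G t e)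
  EveryoneSem^-coind G step (suc m) p a a∈G t e =
    EveryoneSem^-coind G step m (proj₁ (step p a a∈G t e))

module _ {n : ℕ} {X : Letters} {ℓ : Level} (em : ExcludedMiddle ℓ) (𝓜 : Model n ℓ) where
  open Model 𝓜 hiding (W)
  open Equivalence using (to; from)

  -- Excluded middle turns truth at s into a Boolean valuation of the schematic letters.
  instantiate-reflects : (σ : ℕ → Form n X) (s : W 𝓜) (α : PropForm) →
    Reflects (𝓜 , s ⊨ instantiate σ α)
             (eval (λ i → does (em {𝓜 , s ⊨ σ i})) α)
  instantiate-reflects σ s (var i)    = proof em
  instantiate-reflects σ s (neg α)    = ¬-reflects (instantiate-reflects σ s α)
  instantiate-reflects σ s (impl α β) =
    instantiate-reflects σ s α →-reflects instantiate-reflects σ s β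

  ⊨tautology : (α : PropForm) → Tautology α → (σ : ℕ → Form n X) (s : W 𝓜) →
               𝓜 , s ⊨ instantiate σ α
  ⊨tautology α valid σ s =
    -- The Boolean is `eval` at the valuation read off from truth at `s`; `valid` turns it into
    -- `true`.
    invert (subst (Reflects _) (valid _) (instantiate-reflects σ s α))

  -- Both items for `C` put a defined conjunction under `Everyone`; here it becomes a genuine pair
  -- at each successor.
  ⊨Everyone-⋏ : (G : Group n) (φ ψ : Form n X) (s : W 𝓜) →
    (𝓜 , s ⊨ Everyone G (φ ⋏ ψ)) ⇔
    EveryoneSem G (λ t → 𝓜 , t ⊨ φ × 𝓜 , t ⊨ ψ) s
  ⊨Everyone-⋏ G φ ψ s = mk⇔
    (λ h a a∈G t e → to (⊨⋏ em 𝓜 φ ψ t)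
       (to (⊨Everyone em 𝓜 G (φ ⋏ ψ) s) h a a∈G t (λ {x} → e {x})))
    (λ h → from (⊨Everyone em 𝓜 G (φ ⋏ ψ) s)
       (λ a a∈G t e → from (⊨⋏ em 𝓜 φ ψ t) (h a a∈G t (λ {x} → e {x}))))

  ⊨⇔ᶠ : (φ ψ : Form n X) (s : W 𝓜) →
        (𝓜 , s ⊨ φ ⇔ᶠ ψ) ⇔ (𝓜 , s ⊨ (φ ⇒ ψ) × 𝓜 , s ⊨ (ψ ⇒ φ))
  ⊨⇔ᶠ φ ψ = ⊨⋏ em 𝓜 (φ ⇒ ψ) (ψ ⇒ φ)

  -- One induction serves both systems, since similarity is demanded only when `b` is `𝐊𝐁`. The
  -- state stays universally quantified because `nec` and `C-ind` use their premise at other states.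
  sound : ∀ {b} → (b ≡ 𝐊𝐁 → IsSimilarity 𝓜) → {φ : Form n X} →
          b ⟨ X ⟩⊢ φ → ∀ s → 𝓜 , s ⊨ φ
  sound sim (taut α valid σ) s = ⊨tautology α valid σ s
  sound sim (K-K a φ ψ) s = Box-K 𝓜 (cap a)
  sound sim (mp d e) s = sound sim e s (sound sim d s)
  sound sim (nec a d) s t _ = sound sim d t
  sound sim (K-B a φ) s = Box-B 𝓜 (sim refl) (cap a) (𝓜 ,_⊨ φ)
  sound sim (C-mix G φ) s h = from (⊨Everyone-⋏ G φ (C G φ) s)
    -- Index 1 at `s` gives `φ` at `t`; index `suc m` at `s` gives index `m` at `t`, hence `C G φ`
    -- there.
    λ a a∈G t e → h 1 (s≤s z≤n) a a∈G t e ,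
                  λ m 1≤m → h (suc m) (s≤s z≤n) a a∈G t e
  -- Truth of the premise at all states is the coinduction hypothesis; index zero is excluded by
  -- `1 ≤ m`.
  sound sim (C-ind G {φ} {ψ} d) s h (suc m) _ = EveryoneSem^-coind 𝓜 G
    (λ {t} p → to (⊨Everyone-⋏ G φ ψ t) (sound sim d t p)) m h
  sound sim (D-K G φ ψ) s = Box-K 𝓜 (⋃cap G)
  sound sim (D-one a φ) s = from (⊨⇔ᶠ (D (singleton a) φ) (K a φ) s)
    ( Box-monoˡ 𝓜 (𝓜 ,_⊨ φ) (⋃cap⊆cap 𝓜 a)
    , Box-monoˡ 𝓜 (𝓜 ,_⊨ φ) (cap⊆⋃cap 𝓜 a))
  sound sim (D-sub G H φ G⊆H) s =
    Box-monoˡ 𝓜 (𝓜 ,_⊨ φ) (⋃cap-mono 𝓜 G H G⊆H)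
  sound sim (D-B G φ) s = Box-B 𝓜 (sim refl) (⋃cap G) (𝓜 ,_⊨ φ)
  sound sim (M-K G φ ψ) s = Box-K 𝓜 (⋂cap G)
  sound sim (M-one a φ) s = from (⊨⇔ᶠ (M (singleton a) φ) (K a φ) s)
    ( Box-monoˡ 𝓜 (𝓜 ,_⊨ φ) (⋂cap⊆cap 𝓜 a)
    , Box-monoˡ 𝓜 (𝓜 ,_⊨ φ) (cap⊆⋂cap 𝓜 a))
  sound sim (M-sub G H φ H⊆G) s =
    Box-monoˡ 𝓜 (𝓜 ,_⊨ φ) (⋂cap-anti 𝓜 G H H⊆G)
  sound sim (M-B G φ) s = Box-B 𝓜 (sim refl) (⋂cap G) (𝓜 ,_⊨ φ)

theorem20 : ∀ {ℓ : Level} → ExcludedMiddle ℓ →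
    ∀ (n : ℕ) .{{_ : NonZero n}} (X : Letters) →
    (∀ (φ : Form n X) → 𝐊 ⟨ X ⟩⊢ φ → Valid ℓ φ)
    × (∀ (φ : Form n X) → 𝐊𝐁 ⟨ X ⟩⊢ φ → SValid ℓ φ)
theorem20 em n X =
  -- `𝐊 ≡ 𝐊𝐁` is absurd, so the demand for similarity is met by every model.
  (λ φ d 𝓜 → sound em 𝓜 (λ ()) d) ,
  (λ φ d 𝓜 sim → sound em 𝓜 (λ _ → sim) d)
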